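{- Let $\mathbb{F}$ be a field of size more than $D$. Let $f(x_1,\ldots,x_n)\in\mathbb{F}\langle X\rangle$, $X=\{x_1,\ldots,x_n\}$, be a nonzero polynomial of degree $D$ computed by a homogeneous $\Sigma\Pi^{*}\Sigma$ circuit with top gate fan-in $s$ and with the fan-in of the product gates bounded by $D$. Then $f$ is not a polynomial identity for the matrix algebra $\mathbb{M}_s(\mathbb{F})$ of $s\times s$ matrices over $\mathbb{F}$; that is, there exist $M_1,\ldots,M_n\in\mathbb{M}_s(\mathbb{F})$ with $f(M_1,\ldots,M_n)\neq 0$.
   Context: $\mathbb{F}\langle X\rangle$ is the free noncommutative polynomial ring over $\mathbb{F}$ in the noncommuting variables $x_1,\ldots,x_n$. A noncommutative arithmetic circuit is a directed acyclic graph whose input nodes are labeled by variables or scalars and whose internal nodes are sum ($\Sigma$, also $+$) or product ($\Pi$, also $\times$) gates, the inputs of a product gate being ordered and multiplied in that order. It is a homogeneous $\Sigma\Pi^*\Sigma$ circuit if: the output gate is a $\Sigma$ gate; all inputs to the output gate are $\Pi$ gates of the same syntactic degree; and every input-to-output path goes through a $\Sigma$ gate (which computes a homogeneous linear form $\sum_{i=1}^n\alpha_i x_i$, $\alpha_i\in\mathbb{F}$), followed by one or more $\Pi$ gates, and ends at the output $\Sigma$ gate. Thus a homogeneous $\Sigma\Pi^*\Sigma$ circuit with top fan-in $s$ whose product gates have syntactic degree $D$ computes a sum $P_1+\cdots+P_s$, where each $P_i=L_{i,1}L_{i,2}\cdots L_{i,D}$ is an ordered product of $D$ homogeneous linear forms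 in $x_1,\ldots,x_n$. -}

module Defs where

open import Algebra.Apartness using (HeytingCommutativeRing; HeytingField)
open import Algebra.Bundles using (CommutativeRing)
open import Data.Bool using (if_then_else_)
open import Data.Fin using (Fin; zero; suc; _≟_)
open import Data.List using (List; []; _∷_; _++_; map; foldr; cartesianProductWith; replicate; length)
import Data.Nat.ListAction as ℕ
open import Data.List.Membership.Propositional using (_∈_)
open import Data.List.NonEmpty using (List⁺; toList)
open import Data.List.Properties using (≡-dec)
open import Data.List.Relation.Unary.All using (All)
open import Data.Nat using (ℕ; zero; suc; _≤_; _<_; _⊔_)
open import Data.Product using (_×_; _,_; proj₂; ∃; ∃₂)
open import Level using (Level) renaming (_⊔_ to _⊔ˡ_)
open import Relation.Binary.PropositionalEquality using (_≡_; _≢_)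
open import Relation.Nullary using (does)

-- Fields are Heyting fields.  The apartness _#_ is the positive form of
-- "distinct": classically it is the negation of _≈_, and a field with decidable
-- equality is a Heyting field with this negation as its apartness.

module Polynomials {c ℓ₁ ℓ₂ : Level} (F : HeytingField c ℓ₁ ℓ₂) where

  open HeytingField F

  HasMoreThan_Elements : ℕ → Set (c ⊔ˡ ℓ₂)
  HasMoreThan D Elements =
    ∃ λ (a : Fin (suc D) → Carrier) → ∀ {i j} → i ≢ j → a i # a j

  Word : ℕ → Set
  Word n = List (Fin n)

  -- The free algebra F⟨x₁,…,xₙ⟩.  A polynomial is a finite list of terms, in
  -- which a word may occur more than once; equality is _≈ₚ_, not _≡_.

  Poly : ℕ → Set c
  Poly n = List (Carrier × Word n)

  coeff : ∀ {n} → Poly n → Word n → Carrier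
  coeff []            w = 0#
  coeff ((a , v) ∷ f) w = (if does (≡-dec _≟_ v w) then a else 0#) + coeff f w

  infix 4 _≈ₚ_
  _≈ₚ_ : ∀ {n} → Poly n → Poly n → Set ℓ₁
  f ≈ₚ g = ∀ w → coeff f w ≈ coeff g w

  NonzeroPoly : ∀ {n} → Poly n → Set ℓ₂
  NonzeroPoly f = ∃ λ w → coeff f w # 0#

  HasDegree : ∀ {n} → Poly n → ℕ → Set (ℓ₁ ⊔ˡ ℓ₂)
  HasDegree f D = (∃ λ w → length w ≡ D × coeff f w # 0#)
                × (∀ w → D < length w → coeff f w ≈ 0#)

  constₚ : ∀ {n} → Carrier → Poly n
  constₚ a = (a , []) ∷ []

  varₚ : ∀ {n} → Fin n → Poly n
  varₚ x = (1# , x ∷ []) ∷ []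

  infixl 6 _+ₚ_
  _+ₚ_ : ∀ {n} → Poly n → Poly n → Poly n
  _+ₚ_ = _++_

  infixl 7 _*ₚ_
  _*ₚ_ : ∀ {n} → Poly n → Poly n → Poly n
  _*ₚ_ = cartesianProductWith (λ (a , v) (b , w) → a * b , v ++ w)

  Matrix : ℕ → Set c
  Matrix s = Fin s → Fin s → Carrier

  commutativeRing : CommutativeRing c ℓ₁
  commutativeRing = HeytingCommutativeRing.commutativeRing heytingCommutativeRing

  open import Algebra.Properties.CommutativeMonoid.Sum
    (CommutativeRing.+-commutativeMonoid commutativeRing) using (sum)

  1ₘ : ∀ {s} → Matrix s
  1ₘ i j = if does (i ≟ j) then 1# else 0#

  infixl 7 _*ₘ_
  _*ₘ_ : ∀ {s} → Matrix s → Matrix s → Matrix s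
  (A *ₘ B) i j = sum (λ k → A i k * B k j)

  evalWord : ∀ {n s} → (Fin n → Matrix s) → Word n → Matrix s
  evalWord M w = foldr _*ₘ_ 1ₘ (map M w)

  eval : ∀ {n s} → (Fin n → Matrix s) → Poly n → Matrix s
  eval M []            i j = 0#
  eval M ((a , w) ∷ f) i j = a * evalWord M w i j + eval M f i j

  NonzeroMatrix : ∀ {s} → Matrix s → Set ℓ₂
  NonzeroMatrix A = ∃₂ λ i j → A i j # 0#


module Circuits {c ℓ₁ ℓ₂ : Level} (F : HeytingField c ℓ₁ ℓ₂) (n : ℕ) where

  open HeytingField F using (Carrier; 1#)
  open Polynomials F

  -- A gate placed after k earlier gates.  Wires into a Σ gate carry scalars,
  -- so that a single Σ gate over the variables computes Σᵢ αᵢ xᵢ.  The inputs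
  -- of a Π gate are ordered; only var and scalar gates have no inputs.

  data Gate (k : ℕ) : Set c where
    var    : Fin n → Gate k
    scalar : Carrier → Gate k
    sumG   : List⁺ (Carrier × Fin k) → Gate k
    prodG  : List⁺ (Fin k) → Gate k

  -- A directed acyclic graph of k gates, listed in topological order with the
  -- newest on the right.  Node zero is the newest gate; in a nonempty circuit
  -- it is the output gate.

  infixl 5 _▷_
  data Circuit : ℕ → Set c where
    []  : Circuit 0
    _▷_ : ∀ {k} → Circuit k → Gate k → Circuit (suc k)

  inputs : ∀ {k} → Gate k → List (Fin k)
  inputs (var x)    = []
  inputs (scalar a) = []
  inputs (sumG us)  = map proj₂ (toList us)
  inputs (prodG us) = toList us

  data Kind : Set where
    varK scalarK ΣK ΠK : Kind

  kind : ∀ {k} → Gate k → Kind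
  kind (var x)    = varK
  kind (scalar a) = scalarK
  kind (sumG us)  = ΣK
  kind (prodG us) = ΠK

  kindAt : ∀ {k} → Circuit k → Fin k → Kind
  kindAt (C ▷ g) zero    = kind g
  kindAt (C ▷ g) (suc u) = kindAt C u

  fanInAt : ∀ {k} → Circuit k → Fin k → ℕ
  fanInAt (C ▷ g) zero    = length (inputs g)
  fanInAt (C ▷ g) (suc u) = fanInAt C u

  gatePoly : ∀ {k} → (Fin k → Poly n) → Gate k → Poly n
  gatePoly ρ (var x)    = varₚ x
  gatePoly ρ (scalar a) = constₚ a
  gatePoly ρ (sumG us)  = foldr _+ₚ_ [] (map (λ (a , u) → constₚ a *ₚ ρ u) (toList us))
  gatePoly ρ (prodG us) = foldr _*ₚ_ (constₚ 1#) (map ρ (toList us))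

  polyAt : ∀ {k} → Circuit k → Fin k → Poly n
  polyAt (C ▷ g) zero    = gatePoly (polyAt C) g
  polyAt (C ▷ g) (suc u) = polyAt C u

  infix 4 _Computes_
  _Computes_ : ∀ {k} → Circuit (suc k) → Poly n → Set ℓ₁
  C Computes f = polyAt C zero ≈ₚ f

  gateDegree : ∀ {k} → (Fin k → ℕ) → Gate k → ℕ
  gateDegree δ (var x)      = 1
  gateDegree δ (scalar a)   = 0
  gateDegree δ g@(sumG us)  = foldr _⊔_ 0 (map δ (inputs g))
  gateDegree δ g@(prodG us) = ℕ.sum (map δ (inputs g))

  syntacticDegreeAt : ∀ {k} → Circuit k → Fin k → ℕ
  syntacticDegreeAt (C ▷ g) zero    = gateDegree (syntacticDegreeAt C) g
  syntacticDegreeAt (C ▷ g) (suc u) = syntacticDegreeAt C u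

  -- Path C u p : some path from an input node to u runs through gates whose
  -- kinds, read backwards from u, are p.

  data Path : ∀ {k} → Circuit k → Fin k → List Kind → Set c where
    older  : ∀ {k} {C : Circuit k} {g u p} →
             Path C u p → Path (C ▷ g) (suc u) p
    source : ∀ {k} {C : Circuit k} {g} →
             inputs g ≡ [] → Path (C ▷ g) zero (kind g ∷ [])
    wire   : ∀ {k} {C : Circuit k} {g u p} →
             u ∈ inputs g → Path C u p → Path (C ▷ g) zero (kind g ∷ p)

  -- Paths start at variables rather than scalars, which makes the first Σ gate
  -- on each path compute a homogeneous linear form.

  data HomogeneousΣΠ*Σ : ∀ {k} → Circuit (suc k) → Set c where
    homogeneousΣΠ*Σ :
      ∀ {k} {C : Circuit k} {us} {d : ℕ} →
      All (λ u → kindAt C u ≡ ΠK × syntacticDegreeAt C u ≡ d) (inputs (sumG us)) →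
      (∀ {p} → Path (C ▷ sumG us) zero p →
        ∃ λ m → p ≡ ΣK ∷ replicate (suc m) ΠK ++ ΣK ∷ varK ∷ []) →
      HomogeneousΣΠ*Σ (C ▷ sumG us)

  topFanIn : ∀ {k} → Circuit (suc k) → ℕ
  topFanIn C = fanInAt C zero

  ΠFanInBoundedBy : ∀ {k} → ℕ → Circuit k → Set
  ΠFanInBoundedBy D C = ∀ u → kindAt C u ≡ ΠK → fanInAt C u ≤ D

{-# OPTIONS --safe #-}

-- Write f = Σᵢ aᵢ Kᵢ with s products Kᵢ of linear forms.  Read the products letter by letter and choose a
-- pivot form at each letter.  As long as all forms at a letter are proportional to the pivot they can be
-- evaluated at a common commutative point z.  At the first letter where they are not, some 2 × 2 minor is
-- nonzero, and a linear functional on that letter kills one of the products while keeping the sum of the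
-- others nonzero, so at most s - 1 letters have to be singled out.  An upper bidiagonal s × s matrix reads
-- this pattern: its diagonal holds the commutative points, its superdiagonal the functionals, and scaling
-- the points by a parameter t separates, as powers of t, the positions of the singled-out letters.
--
-- Equality in a Heyting field is not decidable, so proportionality is never tested: the point z is found as
-- if all forms were proportional, and when the true value at z may vanish, a minor at z is apart from 0.

module Submission where

open import Defs
open import Algebra.Apartness using (HeytingField; HeytingCommutativeRing)
open import Algebra.Bundles using (CommutativeRing)
import Algebra.Apartness.Properties.HeytingCommutativeRing as HeytingProperties
import Algebra.Properties.Semiring.Sum as SemiringSum
import Algebra.Solver.Ring.NaturalCoefficients.Default as SemiringSolver
open import Data.Bool using (true; false; _∧_; if_then_else_)
open import Data.Empty using (⊥-elim)
open import Data.Fin using (Fin; zero; suc; _≟_; punchIn; inject≤)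
open import Data.Fin.Properties using (punchIn-injective; punchInᵢ≢i; inject≤-injective; suc-injective)
open import Data.List using (List; []; _∷_; _++_; map; length; foldr; replicate; deduplicate)
open import Data.List.Properties using (length-map; ≡-dec; ∷-injective)
open import Data.List.NonEmpty using (toList; _∷_)
open import Data.List.Relation.Unary.All as All using (All; []; _∷_)
import Data.List.Relation.Unary.All.Properties as All
open import Data.List.Membership.Propositional using (_∈_)
open import Data.List.Membership.Propositional.Properties using (∈-++⁺ˡ; ∈-++⁺ʳ; ∈-map⁺; ∈-deduplicate⁺)
open import Data.List.Relation.Unary.AllPairs using (_∷_)
open import Data.List.Relation.Unary.Any using (here; there)
open import Data.List.Relation.Unary.Unique.Propositional using (Unique)
open import Data.List.Relation.Unary.Unique.DecPropositional.Properties using (deduplicate-!)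
open import Data.Nat using (ℕ; zero; suc; _≤_; z≤n; s≤s) renaming (_+_ to _ℕ+_; _⊔_ to _ℕ⊔_)
import Data.Nat.ListAction as ℕ
open import Data.Nat.Properties using (≤-refl; ≤-trans; ≤-reflexive; ⊔-lub; m≥n⇒m⊔n≡m; n≤1+n; m≤m+n; m≤n+m; m≤n⇒m≤1+n; +-suc)
open import Data.Product using (∃; ∃₂; _×_; _,_; proj₁; proj₂)
open import Data.Sum using (_⊎_; inj₁; inj₂; [_,_]′)
open import Data.Vec using (Vec; []; _∷_; head; tail) renaming (_++_ to _++ᵛ_)
open import Data.Vec.Functional using () renaming (_∷_ to _∷ᶠ_)
open import Function using (_∘_)
open import Level using (_⊔_)
open import Relation.Binary.PropositionalEquality using (_≡_; _≢_)
open import Relation.Nullary using (¬_; does; yes; no)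
open import Relation.Nullary.Decidable using (dec-true; dec-false)
import Relation.Binary.PropositionalEquality as ≡
import Relation.Binary.Reasoning.Setoid as SetoidReasoning

-- Arithmetic with apartness, and finite sums.

module FieldLemmas {c ℓ₁ ℓ₂} (F : HeytingField c ℓ₁ ℓ₂) where

  open HeytingField F public
    using (_#_; #-irrefl; #-sym; #-cotrans; #⇒invertible; heytingCommutativeRing)
  open HeytingProperties heytingCommutativeRing public
    using (invertibleˡ⇒#; x-0≈x; #-congʳ; x#0y#0→xy#0)

  R : CommutativeRing c ℓ₁
  R = HeytingCommutativeRing.commutativeRing heytingCommutativeRing

  open CommutativeRing R public hiding (zero)
  open SemiringSum semiring public
    using (sum; sum-cong-≋; sum-replicate-zero; sum-remove; ∑-distrib-+; *-distribˡ-sum)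
  open SemiringSolver commutativeSemiring public
    using (solve; _:=_; _:+_; _:*_; con)
  open SetoidReasoning setoid public hiding (start; stop)

  ¬0#0 : ¬ 0# # 0#
  ¬0#0 = #-irrefl refl

  x≈0⇒¬x#0 : ∀ {x} → x ≈ 0# → ¬ x # 0#
  x≈0⇒¬x#0 x≈0 x#0 = ¬0#0 (#-congʳ x≈0 x#0)

  x#y⇒x-y#0 : ∀ {x y} → x # y → x - y # 0#
  x#y⇒x-y#0 x#y with #⇒invertible x#y
  ... | i , ix≈1 , _ = invertibleˡ⇒# (i , trans (*-congˡ (x-0≈x _)) ix≈1)

  x-y#0⇒x#y : ∀ {x y} → x - y # 0# → x # y
  x-y#0⇒x#y x-y#0 with #⇒invertible x-y#0
  ... | i , ix≈1 , _ = invertibleˡ⇒# (i , trans (*-congˡ (sym (x-0≈x _))) ix≈1)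

  -- If i inverts `x * y`, then `i * y` inverts `x`.
  xy#0⇒x#0 : ∀ {x y} → x * y # 0# → x # 0#
  xy#0⇒x#0 {x} {y} xy#0 with #⇒invertible xy#0
  ... | i , i[xy]≈1 , _ = invertibleˡ⇒# (i * y , (begin
    i * y * (x - 0#)      ≈⟨ *-congˡ (x-0≈x x) ⟩
    i * y * x             ≈⟨ *-assoc i y x ⟩
    i * (y * x)           ≈⟨ *-congˡ (*-comm y x) ⟩
    i * (x * y)           ≈⟨ *-congˡ (x-0≈x _) ⟨
    i * (x * y - 0#)      ≈⟨ i[xy]≈1 ⟩
    1#                    ∎))

  xy#0⇒y#0 : ∀ {x y} → x * y # 0# → y # 0#
  xy#0⇒y#0 = xy#0⇒x#0 ∘ #-congʳ (*-comm _ _)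

  -- Cotransitivity compares `x + y` and 0 with `y`: either `x + y # y`, and subtracting `y` leaves
  -- `x`, or `y # 0#`. This stands in for the undecidable test whether a summand vanishes.
  x+y#0⇒x#0⊎y#0 : ∀ {x y} → x + y # 0# → x # 0# ⊎ y # 0#
  x+y#0⇒x#0⊎y#0 {x} {y} x+y#0 with #-cotrans x+y#0 y
  ... | inj₂ y#0   = inj₂ y#0
  ... | inj₁ x+y#y = inj₁ (#-congʳ x+y-y≈x (x#y⇒x-y#0 x+y#y))
    where
    x+y-y≈x : x + y - y ≈ x
    x+y-y≈x = trans (+-assoc x y (- y)) (trans (+-congˡ (-‿inverseʳ y)) (+-identityʳ x))

  x≈y+[x-y] : ∀ x y → x ≈ y + (x - y)
  x≈y+[x-y] x y = begin
    x               ≈⟨ +-identityʳ x ⟨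
    x + 0#          ≈⟨ +-congˡ (-‿inverseˡ y) ⟨
    x + (- y + y)   ≈⟨ +-assoc x (- y) y ⟨
    x - y + y       ≈⟨ +-comm (x - y) y ⟩
    y + (x - y)     ∎

  sum-zero : ∀ {m} {f : Fin m → Carrier} → (∀ i → f i ≈ 0#) → sum f ≈ 0#
  sum-zero {m} f≈0 = trans (sum-cong-≋ f≈0) (sum-replicate-zero m)

  sum#0 : ∀ {m} {f : Fin m → Carrier} → sum f # 0# → ∃ λ i → f i # 0#
  sum#0 {zero}  p = ⊥-elim (¬0#0 p)
  sum#0 {suc m} p with x+y#0⇒x#0⊎y#0 p
  ... | inj₁ q = zero , q
  ... | inj₂ q with sum#0 q
  ...   | i , r = suc i , r

  sum-δ : ∀ {m} (k : Fin m) (f : Fin m → Carrier) →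
          sum (λ i → (if does (i ≟ k) then 1# else 0#) * f i) ≈ f k
  sum-δ zero    f = begin
    1# * f zero + sum (λ i → 0# * f (suc i)) ≈⟨ +-cong (*-identityˡ _) (sum-zero (λ i → zeroˡ (f (suc i)))) ⟩
    f zero + 0#                              ≈⟨ +-identityʳ _ ⟩
    f zero                                   ∎
  sum-δ (suc k) f = begin
    0# * f zero + sum (λ i → (if does (i ≟ k) then 1# else 0#) * f (suc i)) ≈⟨ +-cong (zeroˡ _) (sum-δ k (f ∘ suc)) ⟩
    0# + f (suc k)                           ≈⟨ +-identityˡ _ ⟩
    f (suc k)                                ∎

  -- Nonroots of univariate polynomials.

  PairwiseApart : ∀ {m} → (Fin m → Carrier) → Set ℓ₂
  PairwiseApart a = ∀ {i j} → i ≢ j → a i # a j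

  evalₚ : ∀ {q} → (Fin q → Carrier) → Carrier → Carrier
  evalₚ {zero}  b t = 0#
  evalₚ {suc q} b t = b zero + t * evalₚ (b ∘ suc) t

  evalₚ-cong : ∀ {q} {b b′ : Fin q → Carrier} t → (∀ j → b j ≈ b′ j) → evalₚ b t ≈ evalₚ b′ t
  evalₚ-cong {zero}  t b≈b′ = refl
  evalₚ-cong {suc q} t b≈b′ = +-cong (b≈b′ zero) (*-congˡ (evalₚ-cong t (b≈b′ ∘ suc)))

  evalₚ-scale : ∀ {q} a (b : Fin q → Carrier) t → evalₚ (λ j → a * b j) t ≈ a * evalₚ b t
  evalₚ-scale {zero}  a b t = sym (zeroʳ a)
  evalₚ-scale {suc q} a b t = begin
    a * b zero + t * evalₚ (λ j → a * b (suc j)) t ≈⟨ +-congˡ (*-congˡ (evalₚ-scale a (b ∘ suc) t)) ⟩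
    a * b zero + t * (a * evalₚ (b ∘ suc) t)
      ≈⟨ solve 4 (λ a x t e → a :* x :+ t :* (a :* e) := a :* (x :+ t :* e)) refl a (b zero) t (evalₚ (b ∘ suc) t) ⟩
    a * (b zero + t * evalₚ (b ∘ suc) t)           ∎

  evalₚ-sum : ∀ {m q} (b : Fin m → Fin q → Carrier) t →
              evalₚ (λ j → sum (λ i → b i j)) t ≈ sum (λ i → evalₚ (b i) t)
  evalₚ-sum {m} {zero}  b t = sym (sum-zero {m} {f = λ _ → 0#} (λ _ → refl))
  evalₚ-sum {m} {suc q} b t = begin
    sum (λ i → b i zero) + t * evalₚ (λ j → sum (λ i → b i (suc j))) t
      ≈⟨ +-congˡ (*-congˡ (evalₚ-sum (λ i → b i ∘ suc) t)) ⟩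
    sum (λ i → b i zero) + t * sum (λ i → evalₚ (b i ∘ suc) t)
      ≈⟨ +-congˡ (*-distribˡ-sum t (λ i → evalₚ (b i ∘ suc) t)) ⟩
    sum (λ i → b i zero) + sum (λ i → t * evalₚ (b i ∘ suc) t)
      ≈⟨ ∑-distrib-+ (λ i → b i zero) (λ i → t * evalₚ (b i ∘ suc) t) ⟨
    sum (λ i → evalₚ (b i) t) ∎

  -- Synthetic division by t - x: by Horner's scheme, coefficient j of the quotient is the value at
  -- x of the part of `b` above j.
  quotient : ∀ {q} → (Fin (suc q) → Carrier) → Carrier → Fin q → Carrier
  quotient b x zero    = evalₚ (b ∘ suc) x
  quotient b x (suc j) = quotient (b ∘ suc) x j

  evalₚ-quotient : ∀ {q} (b : Fin (suc q) → Carrier) x t →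
                   evalₚ b t ≈ evalₚ b x + (t - x) * evalₚ (quotient b x) t
  evalₚ-quotient {zero} b x t = begin
    b zero + t * 0#
      ≈⟨ solve 4 (λ b t x d → b :+ t :* con 0 := b :+ x :* con 0 :+ d :* con 0) refl (b zero) t x (t - x) ⟩
    b zero + x * 0# + (t - x) * 0#       ∎
  evalₚ-quotient {suc q} b x t = begin
    b₀ + t * evalₚ b′ t                       ≈⟨ +-congˡ (*-congˡ (evalₚ-quotient b′ x t)) ⟩
    b₀ + t * (p + (t - x) * r)
      ≈⟨ +-congˡ (solve 4 (λ t p d r → t :* (p :+ d :* r) := t :* p :+ d :* (t :* r)) refl t p (t - x) r) ⟩
    b₀ + (t * p + (t - x) * (t * r))          ≈⟨ +-congˡ (+-congʳ (*-congʳ (x≈y+[x-y] t x))) ⟩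
    b₀ + ((x + (t - x)) * p + (t - x) * (t * r))
      ≈⟨ solve 6 (λ b x d p t r → b :+ ((x :+ d) :* p :+ d :* (t :* r)) := b :+ x :* p :+ d :* (p :+ t :* r))
          refl b₀ x (t - x) p t r ⟩
    b₀ + x * p + (t - x) * (p + t * r)        ∎
    where
    b₀ = b zero
    b′ = b ∘ suc
    p = evalₚ b′ x
    r = evalₚ (quotient b′ x) t

  -- The difference of `x` and `y` is `z`, so they are apart, and 0 is apart from one of them.
  x≈y+z⇒z#0⇒x#0⊎y#0 : ∀ {x y z} → x ≈ y + z → z # 0# → x # 0# ⊎ y # 0#
  x≈y+z⇒z#0⇒x#0⊎y#0 {x} {y} {z} x≈y+z z#0 with #-cotrans x#y 0#
    where
    x-y≈z : x - y ≈ z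
    x-y≈z = begin
      x - y           ≈⟨ +-congʳ (trans x≈y+z (+-comm y z)) ⟩
      z + y - y       ≈⟨ +-assoc z y (- y) ⟩
      z + (y - y)     ≈⟨ +-congˡ (-‿inverseʳ y) ⟩
      z + 0#          ≈⟨ +-identityʳ z ⟩
      z               ∎
    x#y = x-y#0⇒x#y (#-congʳ (sym x-y≈z) z#0)
  ... | inj₁ x#0 = inj₁ x#0
  ... | inj₂ 0#y = inj₂ (#-sym 0#y)

  -- The constant coefficient is the value at x minus x times the constant coefficient of the
  -- quotient, so one of these two is apart from 0. For a higher coefficient, induct on the shifted
  -- polynomial, whose value at x is the constant coefficient of the quotient.
  quotient#0 : ∀ {q} (b : Fin (suc q) → Carrier) x j → b j # 0# →
               evalₚ b x # 0# ⊎ ∃ λ k → quotient b x k # 0#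
  quotient#0 {zero}  b x zero    b₀#0 = inj₁ (#-congʳ (sym (trans (+-congˡ (zeroʳ x)) (+-identityʳ _))) b₀#0)
  quotient#0 {suc q} b x zero    b₀#0 with x≈y+z⇒z#0⇒x#0⊎y#0 (+-comm (b zero) (x * evalₚ (b ∘ suc) x)) b₀#0
  ... | inj₁ bx#0 = inj₁ bx#0
  ... | inj₂ xr#0 = inj₂ (zero , xy#0⇒y#0 xr#0)
  quotient#0 {suc q} b x (suc j) bⱼ#0 with quotient#0 (b ∘ suc) x j bⱼ#0
  ... | inj₁ r#0       = inj₂ (zero , r#0)
  ... | inj₂ (k , r#0) = inj₂ (suc k , r#0)

  -- A polynomial with q coefficients has degree below q, so q points suffice. Whether the first
  -- point is a root is never decided: if the quotient r there is nonzero, induction gives a later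
  -- point where r is apart from 0, so the values of the polynomial at the two points differ and one
  -- of them is apart from 0.
  nonroot : ∀ {q} (b a : Fin q → Carrier) → PairwiseApart a →
            (∃ λ j → b j # 0#) → ∃ λ i → evalₚ b (a i) # 0#
  nonroot {suc q} b a apart (j , bⱼ#0) = [ (λ e#0 → zero , e#0) , step ]′ (quotient#0 b a₀ j bⱼ#0)
    where
    a₀ = a zero
    r = quotient b a₀
    step : (∃ λ k → r k # 0#) → ∃ λ i → evalₚ b (a i) # 0#
    step k#0 with nonroot r (a ∘ suc) (λ i≢j → apart (i≢j ∘ suc-injective)) k#0
    ... | i , r#0 = [ (λ e#0 → suc i , e#0) , (λ e#0 → zero , e#0) ]′
      (x≈y+z⇒z#0⇒x#0⊎y#0 {evalₚ b aᵢ} {evalₚ b a₀} {(aᵢ - a₀) * evalₚ r aᵢ} (evalₚ-quotient b a₀ aᵢ) (x#0y#0→xy#0 aᵢ-a₀#0 r#0))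
      where
      aᵢ = a (suc i)
      aᵢ-a₀#0 : aᵢ - a₀ # 0#
      aᵢ-a₀#0 = x#y⇒x-y#0 (apart λ ())

  -- Common nonroots of affine functions.

  affine : Carrier × Carrier → Carrier → Carrier
  affine (α , β) t = α + t * β

  Nonzeroᵃ : Carrier × Carrier → Set ℓ₂
  Nonzeroᵃ (α , β) = α # 0# ⊎ β # 0#

  -- With ℓ(t) = α + tβ, the combinations ℓ(t) - ℓ(u) = (t - u)β and tℓ(u) - uℓ(t) = (t - u)α are
  -- apart from 0 when β or α is.
  affine-two-points : ∀ ℓ {t u} → Nonzeroᵃ ℓ → t # u → affine ℓ t # 0# ⊎ affine ℓ u # 0#
  affine-two-points (α , β) {t} {u} ℓ#0 t#u = [ α#0-case , β#0-case ]′ ℓ#0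
    where
    d = t - u
    d#0 : d # 0#
    d#0 = x#y⇒x-y#0 t#u

    β#0-case : β # 0# → α + t * β # 0# ⊎ α + u * β # 0#
    β#0-case β#0 = x≈y+z⇒z#0⇒x#0⊎y#0 {α + t * β} {α + u * β} {d * β} (begin
      α + t * β                 ≈⟨ +-congˡ (*-congʳ (x≈y+[x-y] t u)) ⟩
      α + (u + d) * β           ≈⟨ solve 4 (λ α u d β → α :+ (u :+ d) :* β := α :+ u :* β :+ d :* β) refl α u d β ⟩
      α + u * β + d * β         ∎) (x#0y#0→xy#0 d#0 β#0)

    t[α+uβ] : t * (α + u * β) ≈ u * (α + t * β) + d * α
    t[α+uβ] = begin
      t * (α + u * β)
        ≈⟨ solve 4 (λ t α u β → t :* (α :+ u :* β) := u :* (t :* β) :+ t :* α) refl t α u β ⟩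
      u * (t * β) + t * α               ≈⟨ +-congˡ (*-congʳ (x≈y+[x-y] t u)) ⟩
      u * (t * β) + (u + d) * α
        ≈⟨ solve 5 (λ t α u β d → u :* (t :* β) :+ (u :+ d) :* α := u :* (α :+ t :* β) :+ d :* α) refl t α u β d ⟩
      u * (α + t * β) + d * α           ∎

    α#0-case : α # 0# → α + t * β # 0# ⊎ α + u * β # 0#
    α#0-case α#0 = [ (λ p → inj₂ (xy#0⇒y#0 p)) , (λ p → inj₁ (xy#0⇒y#0 p)) ]′
      (x≈y+z⇒z#0⇒x#0⊎y#0 {t * (α + u * β)} {u * (α + t * β)} {d * α} t[α+uβ] (x#0y#0→xy#0 d#0 α#0))

  -- The positive form of "at most one root": the index returned is only a suspect. Each new point
  -- is compared with the current suspect by `affine-two-points`, and whichever of the two has a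
  -- value apart from 0 is cleared.
  affine-one-root : ∀ {m} (a : Fin (suc m) → Carrier) ℓ → PairwiseApart a → Nonzeroᵃ ℓ →
                    ∃ λ i → ∀ j → j ≢ i → affine ℓ (a j) # 0#
  affine-one-root {zero}  a ℓ apart ℓ#0 = zero , λ { zero 0≢0 → ⊥-elim (0≢0 ≡.refl) }
  affine-one-root {suc m} a ℓ apart ℓ#0 = extend (affine-one-root (a ∘ suc) ℓ (λ i≢j → apart (i≢j ∘ suc-injective)) ℓ#0)
    where
    extend : (∃ λ i → ∀ j → j ≢ i → affine ℓ (a (suc j)) # 0#) → ∃ λ i → ∀ j → j ≢ i → affine ℓ (a j) # 0#
    extend (i , good) = [ root-suc , root-zero ]′ (affine-two-points ℓ {a zero} {a (suc i)} ℓ#0 (apart λ ()))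
      where
      root-suc : affine ℓ (a zero) # 0# → ∃ λ i → ∀ j → j ≢ i → affine ℓ (a j) # 0#
      root-suc p = suc i , λ { zero _ → p ; (suc j) j≢i → good j (j≢i ∘ ≡.cong suc) }

      root-zero : affine ℓ (a (suc i)) # 0# → ∃ λ i → ∀ j → j ≢ i → affine ℓ (a j) # 0#
      root-zero p = zero , nonzero
        where
        nonzero : ∀ j → j ≢ zero → affine ℓ (a j) # 0#
        nonzero zero    0≢0 = ⊥-elim (0≢0 ≡.refl)
        nonzero (suc j) _ with j ≟ i
        ... | yes ≡.refl = p
        ... | no j≢i     = good j j≢i

  -- Each function rules out at most one point, which `punchIn` removes, so one point more than
  -- there are functions is enough.
  affines-nonroot : ∀ {m} (a : Fin (suc m) → Carrier) → PairwiseApart a → (ℓs : List (Carrier × Carrier)) →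
                    length ℓs ≤ m → All Nonzeroᵃ ℓs → ∃ λ i → All (λ ℓ → affine ℓ (a i) # 0#) ℓs
  affines-nonroot a apart [] _ [] = zero , []
  affines-nonroot a apart (ℓ ∷ ℓs) (s≤s len) (ℓ#0 ∷ ℓs#0) = avoid (affine-one-root a ℓ apart ℓ#0)
    where
    avoid : (∃ λ i → ∀ j → j ≢ i → affine ℓ (a j) # 0#) → ∃ λ i → All (λ ℓ → affine ℓ (a i) # 0#) (ℓ ∷ ℓs)
    avoid (i , good) = let j , rest = affines-nonroot a′ apart′ ℓs len ℓs#0 in
      punchIn i j , good (punchIn i j) (punchInᵢ≢i i j) ∷ rest
      where
      a′ = a ∘ punchIn i
      apart′ : PairwiseApart a′
      apart′ {j} {k} j≢k = apart (λ e → j≢k (punchIn-injective i j k e))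

  -- Weighted sums and 2 × 2 minors.

  module _ {m} (c a b : Fin m → Carrier) where

    -- The determinant formed from columns k and i of the matrix with rows `b` and `a`. All of them
    -- vanish when the two rows are proportional.
    minor : Fin m → Fin m → Carrier
    minor k i = b k * a i + - a k * b i

    minor-diagonal : ∀ k → minor k k ≈ 0#
    minor-diagonal k = begin
      b k * a k + - a k * b k    ≈⟨ solve 3 (λ a b n → b :* a :+ n :* b := (a :+ n) :* b) refl (a k) (b k) (- a k) ⟩
      (a k - a k) * b k          ≈⟨ *-congʳ (-‿inverseʳ (a k)) ⟩
      0# * b k                   ≈⟨ zeroˡ (b k) ⟩
      0#                         ∎

    -- Multiplied by `b k`, the given sum becomes `a k` times the sum with `b` in place of `a`, plus
    -- a sum of multiples of the minors. So either `a` can be replaced by `b`, or some minor is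
    -- responsible for the failure.
    weighted-sum⊎minor#0 : ∀ (φ : Fin m → Carrier) k → b k # 0# → sum (λ i → c i * a i * φ i) # 0# →
      sum (λ i → c i * (b i * φ i)) # 0# ⊎ ∃ λ i → minor k i # 0#
    weighted-sum⊎minor#0 φ k bₖ#0 Σ#0 = [ (λ p → inj₁ (xy#0⇒y#0 p)) , (λ p → inj₂ (minor#0 (sum#0 p))) ]′
        (x+y#0⇒x#0⊎y#0 {a k * sum (λ i → c i * (b i * φ i))} {sum (λ i → c i * minor k i * φ i)}
          (#-congʳ expand (x#0y#0→xy#0 bₖ#0 Σ#0)))
      where
      minor#0 : (∃ λ i → c i * minor k i * φ i # 0#) → ∃ λ i → minor k i # 0#
      minor#0 (i , p) = i , xy#0⇒y#0 (xy#0⇒x#0 p)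

      pointwise : ∀ i → b k * (c i * a i * φ i) ≈ a k * (c i * (b i * φ i)) + c i * minor k i * φ i
      pointwise i = begin
        b k * (c i * a i * φ i)
          -- The semiring identity below treats negatives as independent variables, so the
          -- cancellation `a k - a k` is put in beforehand as a zero term.
          ≈⟨ +-identityˡ _ ⟨
        0# + b k * (c i * a i * φ i)
          ≈⟨ +-congʳ (zeroˡ (c i * (b i * φ i))) ⟨
        0# * (c i * (b i * φ i)) + b k * (c i * a i * φ i)
          ≈⟨ +-congʳ (*-congʳ (-‿inverseʳ (a k))) ⟨
        (a k - a k) * (c i * (b i * φ i)) + b k * (c i * a i * φ i)
          ≈⟨ solve 7 (λ aₖ bₖ n c a b φ → (aₖ :+ n) :* (c :* (b :* φ)) :+ bₖ :* (c :* a :* φ)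
                := aₖ :* (c :* (b :* φ)) :+ c :* (bₖ :* a :+ n :* b) :* φ)
                    refl (a k) (b k) (- a k) (c i) (a i) (b i) (φ i) ⟩
        a k * (c i * (b i * φ i)) + c i * minor k i * φ i ∎

      expand : b k * sum (λ i → c i * a i * φ i)
             ≈ a k * sum (λ i → c i * (b i * φ i)) + sum (λ i → c i * minor k i * φ i)
      expand = begin
        b k * sum (λ i → c i * a i * φ i)
          ≈⟨ *-distribˡ-sum (b k) (λ i → c i * a i * φ i) ⟩
        sum (λ i → b k * (c i * a i * φ i))
          ≈⟨ sum-cong-≋ pointwise ⟩
        sum (λ i → a k * (c i * (b i * φ i)) + c i * minor k i * φ i)
          ≈⟨ ∑-distrib-+ (λ i → a k * (c i * (b i * φ i))) (λ i → c i * minor k i * φ i) ⟩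
        sum (λ i → a k * (c i * (b i * φ i))) + sum (λ i → c i * minor k i * φ i)
          ≈⟨ +-congʳ (*-distribˡ-sum (a k) (λ i → c i * (b i * φ i))) ⟨
        a k * sum (λ i → c i * (b i * φ i)) + sum (λ i → c i * minor k i * φ i) ∎

    -- As a function of i, minor h vanishes at h, so the resulting sum has one term fewer.
    minor-sum#0 : ∀ (κ : Fin m → Carrier) k l → minor k l # 0# → sum (λ i → c i * (a i * κ i)) # 0# →
      ∃ λ h → sum (λ i → c i * minor h i * κ i) # 0#
    minor-sum#0 κ k l m#0 Σ#0 = [ (λ p → k , xy#0⇒y#0 p) , (λ p → l , xy#0⇒y#0 p) ]′
        (x+y#0⇒x#0⊎y#0 {a l * sum (λ i → c i * minor k i * κ i)} { - a k * sum (λ i → c i * minor l i * κ i)}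
          (#-congʳ expand (x#0y#0→xy#0 m#0 Σ#0)))
      where
      -- This rests on the relation minor(k,l) a(i) = a(l) minor(k,i) - a(k) minor(l,i). Hence one
      -- of the two sums on the right is apart from 0, and h is k or l accordingly.
      pointwise : ∀ i → minor k l * (c i * (a i * κ i)) ≈ a l * (c i * minor k i * κ i) + - a k * (c i * minor l i * κ i)
      pointwise i = begin
        minor k l * (c i * (a i * κ i))
          ≈⟨ +-identityʳ _ ⟨
        minor k l * (c i * (a i * κ i)) + 0#
          ≈⟨ +-congˡ (zeroˡ (- a k * (c i * (b i * κ i)))) ⟨
        minor k l * (c i * (a i * κ i)) + 0# * (- a k * (c i * (b i * κ i)))
          ≈⟨ +-congˡ (*-congʳ (-‿inverseʳ (a l))) ⟨
        minor k l * (c i * (a i * κ i)) + (a l - a l) * (- a k * (c i * (b i * κ i)))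
          ≈⟨ solve 9 (λ bₖ nₖ aₗ bₗ nₗ c a b κ →
               (bₖ :* aₗ :+ nₖ :* bₗ) :* (c :* (a :* κ)) :+ (aₗ :+ nₗ) :* (nₖ :* (c :* (b :* κ)))
                 := aₗ :* (c :* (bₖ :* a :+ nₖ :* b) :* κ) :+ nₖ :* (c :* (bₗ :* a :+ nₗ :* b) :* κ))
               refl (b k) (- a k) (a l) (b l) (- a l) (c i) (a i) (b i) (κ i) ⟩
        a l * (c i * minor k i * κ i) + - a k * (c i * minor l i * κ i) ∎

      expand : minor k l * sum (λ i → c i * (a i * κ i))
             ≈ a l * sum (λ i → c i * minor k i * κ i) + - a k * sum (λ i → c i * minor l i * κ i)
      expand = begin
        minor k l * sum (λ i → c i * (a i * κ i))
          ≈⟨ *-distribˡ-sum (minor k l) (λ i → c i * (a i * κ i)) ⟩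
        sum (λ i → minor k l * (c i * (a i * κ i)))
          ≈⟨ sum-cong-≋ pointwise ⟩
        sum (λ i → a l * (c i * minor k i * κ i) + - a k * (c i * minor l i * κ i))
          ≈⟨ ∑-distrib-+ (λ i → a l * (c i * minor k i * κ i)) (λ i → - a k * (c i * minor l i * κ i)) ⟩
        sum (λ i → a l * (c i * minor k i * κ i)) + sum (λ i → - a k * (c i * minor l i * κ i))
          ≈⟨ +-cong (*-distribˡ-sum (a l) (λ i → c i * minor k i * κ i)) (*-distribˡ-sum (- a k) (λ i → c i * minor l i * κ i)) ⟨
        a l * sum (λ i → c i * minor k i * κ i) + - a k * sum (λ i → c i * minor l i * κ i) ∎

-- Linear forms, their products, and chains.

module LinearForms {c ℓ₁ ℓ₂} (F : HeytingField c ℓ₁ ℓ₂) (n : ℕ) where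

  open FieldLemmas F
  open Polynomials F using (Word; Matrix; evalWord)

  Form : Set c
  Form = Fin n → Carrier

  ⟪_,_⟫ : Form → Form → Carrier
  ⟪ L , z ⟫ = sum (λ x → L x * z x)

  scale : Carrier → Form → Form
  scale t z x = t * z x

  combine : Carrier → Form → Carrier → Form → Form
  combine α z β u x = α * z x + β * u x

  unit : Fin n → Form
  unit x y = if does (y ≟ x) then 1# else 0#

  ⟪,scale⟫ : ∀ L t z → ⟪ L , scale t z ⟫ ≈ t * ⟪ L , z ⟫
  ⟪,scale⟫ L t z = begin
    sum (λ x → L x * (t * z x))
      ≈⟨ sum-cong-≋ (λ x → solve 3 (λ l t z → l :* (t :* z) := t :* (l :* z)) refl (L x) t (z x)) ⟩
    sum (λ x → t * (L x * z x))   ≈⟨ *-distribˡ-sum t (λ x → L x * z x) ⟨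
    t * ⟪ L , z ⟫                 ∎

  ⟪,combine⟫ : ∀ L α z β u → ⟪ L , combine α z β u ⟫ ≈ α * ⟪ L , z ⟫ + β * ⟪ L , u ⟫
  ⟪,combine⟫ L α z β u = begin
    sum (λ x → L x * (α * z x + β * u x))
      ≈⟨ sum-cong-≋ (λ x → distribˡ (L x) (α * z x) (β * u x)) ⟩
    sum (λ x → L x * (α * z x) + L x * (β * u x))
      ≈⟨ ∑-distrib-+ (λ x → L x * (α * z x)) (λ x → L x * (β * u x)) ⟩
    ⟪ L , scale α z ⟫ + ⟪ L , scale β u ⟫                       ≈⟨ +-cong (⟪,scale⟫ L α z) (⟪,scale⟫ L β u) ⟩
    α * ⟪ L , z ⟫ + β * ⟪ L , u ⟫                               ∎

  ⟪,unit⟫ : ∀ L x → ⟪ L , unit x ⟫ ≈ L x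
  ⟪,unit⟫ L x = begin
    sum (λ y → L y * unit x y)  ≈⟨ sum-cong-≋ (λ y → *-comm (L y) (unit x y)) ⟩
    sum (λ y → unit x y * L y)  ≈⟨ sum-δ x L ⟩
    L x                         ∎

  -- The linear extension of `E` from words to polynomials, applied to the ordered product of the
  -- forms in `K` without expanding that product.
  prodEval : ∀ {q} → Vec Form q → (Word n → Carrier) → Carrier
  prodEval {zero}  K E = E []
  prodEval {suc q} K E = sum (λ x → head K x * prodEval (tail K) (λ w → E (x ∷ w)))

  coef : ∀ {q} → Vec Form q → Word n → Carrier
  coef {zero}  K []      = 1#
  coef {zero}  K (x ∷ w) = 0#
  coef {suc q} K []      = 0#
  coef {suc q} K (x ∷ w) = head K x * coef (tail K) w

  prodEval-cong : ∀ {q} (K : Vec Form q) {E E′} → (∀ w → E w ≈ E′ w) → prodEval K E ≈ prodEval K E′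
  prodEval-cong {zero}  K E≈E′ = E≈E′ []
  prodEval-cong {suc q} K E≈E′ = sum-cong-≋ (λ x → *-congˡ {head K x} (prodEval-cong (tail K) (λ w → E≈E′ (x ∷ w))))

  prodEval-+ : ∀ {q} (K : Vec Form q) E E′ → prodEval K (λ w → E w + E′ w) ≈ prodEval K E + prodEval K E′
  prodEval-+ {zero}  K E E′ = refl
  prodEval-+ {suc q} K E E′ = begin
    sum (λ x → head K x * prodEval (tail K) (λ w → E (x ∷ w) + E′ (x ∷ w)))
      ≈⟨ sum-cong-≋ (λ x → trans (*-congˡ (prodEval-+ (tail K) (E ∘ (x ∷_)) (E′ ∘ (x ∷_)))) (distribˡ (head K x) _ _)) ⟩
    sum (λ x → head K x * prodEval (tail K) (E ∘ (x ∷_)) + head K x * prodEval (tail K) (E′ ∘ (x ∷_)))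
      ≈⟨ ∑-distrib-+ (λ x → head K x * prodEval (tail K) (E ∘ (x ∷_))) (λ x → head K x * prodEval (tail K) (E′ ∘ (x ∷_))) ⟩
    prodEval K E + prodEval K E′ ∎

  prodEval-* : ∀ {q} (K : Vec Form q) a E → prodEval K (λ w → a * E w) ≈ a * prodEval K E
  prodEval-* {zero}  K a E = refl
  prodEval-* {suc q} K a E = begin
    sum (λ x → head K x * prodEval (tail K) (λ w → a * E (x ∷ w)))
      ≈⟨ sum-cong-≋ (λ x → *-congˡ {head K x} (prodEval-* (tail K) a (E ∘ (x ∷_)))) ⟩
    sum (λ x → head K x * (a * prodEval (tail K) (E ∘ (x ∷_))))
      ≈⟨ sum-cong-≋ (λ x → solve 3 (λ l a e → l :* (a :* e) := a :* (l :* e))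
          refl (head K x) a (prodEval (tail K) (E ∘ (x ∷_)))) ⟩
    sum (λ x → a * (head K x * prodEval (tail K) (E ∘ (x ∷_))))
      ≈⟨ *-distribˡ-sum a (λ x → head K x * prodEval (tail K) (E ∘ (x ∷_))) ⟨
    a * prodEval K E ∎

  -- A chain with s states becomes an s × s matrix even when it stops early; later states are unreachable.
  data Chain : ℕ → Set c where
    stop : ∀ {s} → Form → Chain (suc s)
    step : ∀ {s} → Form → Form → Chain s → Chain (suc s)

  -- The weight of a word in a weighted automaton: every state loops with weight `z`, a `step` state
  -- moves on with weight `y`, and only the `stop` state accepts.
  chainWord : ∀ {s} → Chain s → Word n → Carrier
  chainWord (stop z)         []      = 1#
  chainWord (stop {s} z)     (x ∷ w) = z x * chainWord (stop {s} z) w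
  chainWord (step z y r)     []      = 0#
  chainWord (step z y r)     (x ∷ w) = z x * chainWord (step z y r) w + y x * chainWord r w

  chainEval : ∀ {s q} → Chain s → Vec Form q → Carrier
  chainEval {q = zero}  (stop z)     K = 1#
  chainEval {q = suc q} (stop {s} z)   K = ⟪ head K , z ⟫ * chainEval (stop {s} z) (tail K)
  chainEval {q = zero}  (step z y r) K = 0#
  chainEval {q = suc q} (step z y r) K =
    ⟪ head K , z ⟫ * chainEval (step z y r) (tail K) + ⟪ head K , y ⟫ * chainEval r (tail K)

  pull-form : ∀ L z E → sum (λ x → L x * (z x * E)) ≈ ⟪ L , z ⟫ * E
  pull-form L z E = begin
    sum (λ x → L x * (z x * E))
      ≈⟨ sum-cong-≋ (λ x → solve 3 (λ l z e → l :* (z :* e) := e :* (l :* z)) refl (L x) (z x) E) ⟩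
    sum (λ x → E * (L x * z x))  ≈⟨ *-distribˡ-sum E (λ x → L x * z x) ⟨
    E * ⟪ L , z ⟫                ≈⟨ *-comm E ⟪ L , z ⟫ ⟩
    ⟪ L , z ⟫ * E                ∎

  -- A letter contributes linearly to the weight of a word, so summing over the letters of a form
  -- `L` turns the weight `z x` into `⟪ L , z ⟫`.
  prodEval-chainWord : ∀ {s q} (r : Chain s) (K : Vec Form q) → prodEval K (chainWord r) ≈ chainEval r K
  prodEval-chainWord {q = zero}  (stop z)     K = refl
  prodEval-chainWord {q = suc q} (stop {s} z)   K = begin
    sum (λ x → head K x * prodEval (tail K) (λ w → z x * chainWord (stop {s} z) w))
      ≈⟨ sum-cong-≋ (λ x → *-congˡ {head K x} (prodEval-* (tail K) (z x) (chainWord (stop {s} z)))) ⟩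
    sum (λ x → head K x * (z x * prodEval (tail K) (chainWord (stop {s} z))))
      ≈⟨ pull-form (head K) z (prodEval (tail K) (chainWord (stop {s} z))) ⟩
    ⟪ head K , z ⟫ * prodEval (tail K) (chainWord (stop {s} z))
      ≈⟨ *-congˡ (prodEval-chainWord (stop {s} z) (tail K)) ⟩
    ⟪ head K , z ⟫ * chainEval (stop {s} z) (tail K) ∎
  prodEval-chainWord {q = zero}  (step z y r) K = refl
  prodEval-chainWord {q = suc q} (step z y r) K = begin
    sum (λ x → H x * prodEval T (λ w → z x * chainWord r⁺ w + y x * chainWord r w))
      ≈⟨ sum-cong-≋ (λ x → *-congˡ {H x} (trans (prodEval-+ T (λ w → z x * chainWord r⁺ w) (λ w → y x * chainWord r w))
           (+-cong (prodEval-* T (z x) (chainWord r⁺)) (prodEval-* T (y x) (chainWord r))))) ⟩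
    sum (λ x → H x * (z x * prodEval T (chainWord r⁺) + y x * prodEval T (chainWord r)))
      ≈⟨ sum-cong-≋ (λ x → distribˡ (H x) (z x * prodEval T (chainWord r⁺)) (y x * prodEval T (chainWord r))) ⟩
    sum (λ x → H x * (z x * prodEval T (chainWord r⁺)) + H x * (y x * prodEval T (chainWord r)))
      ≈⟨ ∑-distrib-+ (λ x → H x * (z x * prodEval T (chainWord r⁺))) (λ x → H x * (y x * prodEval T (chainWord r))) ⟩
    sum (λ x → H x * (z x * prodEval T (chainWord r⁺))) + sum (λ x → H x * (y x * prodEval T (chainWord r)))
      ≈⟨ +-cong (pull-form H z (prodEval T (chainWord r⁺))) (pull-form H y (prodEval T (chainWord r))) ⟩
    ⟪ H , z ⟫ * prodEval T (chainWord r⁺) + ⟪ H , y ⟫ * prodEval T (chainWord r)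
      ≈⟨ +-cong (*-congˡ (prodEval-chainWord r⁺ T)) (*-congˡ (prodEval-chainWord r T)) ⟩
    ⟪ H , z ⟫ * chainEval r⁺ T + ⟪ H , y ⟫ * chainEval r T ∎
    where
    H = head K
    T = tail K
    r⁺ = step z y r

  -- Chains as upper bidiagonal matrices.

  start : ∀ {s} → Chain s → Fin s
  start (stop z)     = zero
  start (step z y r) = zero

  end : ∀ {s} → Chain s → Fin s
  end (stop z)     = zero
  end (step z y r) = suc (end r)

  -- The transition matrix of the automaton for one letter: loops on the diagonal, moves to the next
  -- state on the superdiagonal, and zeros for the states beyond `stop`.
  chainMatrix : ∀ {s} → Chain s → Fin n → Matrix s
  chainMatrix (stop z)     x zero    zero    = z x
  chainMatrix (stop z)     x _       _       = 0#
  chainMatrix (step z y r) x zero    zero    = z x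
  chainMatrix (step z y r) x zero    (suc j) = (if does (j ≟ start r) then 1# else 0#) * y x
  chainMatrix (step z y r) x (suc i) zero    = 0#
  chainMatrix (step z y r) x (suc i) (suc j) = chainMatrix r x i j

  -- The matrices are block upper triangular, so their lower right blocks multiply among themselves.
  evalWord-lower : ∀ {s} z y (r : Chain s) w i j →
    evalWord (chainMatrix (step z y r)) w (suc i) (suc j) ≈ evalWord (chainMatrix r) w i j
  evalWord-lower z y r []      i j = refl
  evalWord-lower z y r (x ∷ w) i j =
    trans (+-cong (zeroˡ _) (sum-cong-≋ (λ k → *-congˡ {chainMatrix r x i k} (evalWord-lower z y r w k j)))) (+-identityˡ _)

  -- An entry of a product of transition matrices sums the weights of the paths between two states.
  -- Only the loop and the move to `start r` contribute to the first row.
  evalWord-chainMatrix : ∀ {s} (r : Chain s) w → evalWord (chainMatrix r) w (start r) (end r) ≈ chainWord r w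
  evalWord-chainMatrix (stop z) []      = refl
  evalWord-chainMatrix (stop {s} z) (x ∷ w) =
    trans (+-cong (*-congˡ (evalWord-chainMatrix (stop {s} z) w))
      (sum-zero {s} (λ k → zeroˡ (evalWord (chainMatrix (stop z)) w (suc k) zero)))) (+-identityʳ _)
  evalWord-chainMatrix (step z y r) []      = refl
  evalWord-chainMatrix (step z y r) (x ∷ w) = +-cong (*-congˡ (evalWord-chainMatrix (step z y r) w)) (begin
    sum (λ j → δ j * y x * evalWord M w (suc j) (suc (end r)))
      ≈⟨ sum-cong-≋ (λ j → trans (*-assoc (δ j) (y x) _) (*-congˡ (*-congˡ (evalWord-lower z y r w j (end r))))) ⟩
    sum (λ j → δ j * (y x * evalWord (chainMatrix r) w j (end r)))
      ≈⟨ sum-δ (start r) (λ j → y x * evalWord (chainMatrix r) w j (end r)) ⟩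
    y x * evalWord (chainMatrix r) w (start r) (end r)
      ≈⟨ *-congˡ (evalWord-chainMatrix r w) ⟩
    y x * chainWord r w ∎)
    where
    M = chainMatrix (step z y r)
    δ : Fin _ → Carrier
    δ j = if does (j ≟ start r) then 1# else 0#

  -- Separating a sum of products by a chain.

  NonzeroForm : Form → Set (c ⊔ ℓ₂)
  NonzeroForm L = ∃ λ z → ⟪ L , z ⟫ # 0#

  module _ {D} (points : Fin (suc D) → Carrier) (apart : PairwiseApart points) where

    -- Forms are added one at a time. On the line z + tu, with z the point found so far and u a
    -- point where the new form is nonzero, all forms restrict to nonzero affine functions of t.
    -- There are at most D of them, so one of the D + 1 values of t avoids every root.
    common-nonzero : (V : List Form) → length V ≤ D → All NonzeroForm V → ∃ λ z → All (λ L → ⟪ L , z ⟫ # 0#) V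
    common-nonzero []      _   []                 = (λ _ → 0#) , []
    common-nonzero (L ∷ V) len ((u , L[u]#0) ∷ V#0) =
      combine 1# z (points i) u , All.map (λ {L} → #-congʳ (on-line L)) (All.map⁻ values#0)
      where
      earlier = common-nonzero V (≤-trans (n≤1+n _) len) V#0
      z = proj₁ earlier
      restrict : Form → Carrier × Carrier
      restrict L = ⟪ L , z ⟫ , ⟪ L , u ⟫
      found = affines-nonroot points apart (map restrict (L ∷ V)) (≤-trans (≤-reflexive (length-map restrict (L ∷ V))) len)
                (All.map⁺ {f = restrict} (inj₂ L[u]#0 ∷ All.map inj₁ (proj₂ earlier)))
      i = proj₁ found
      values#0 = proj₂ found
      on-line : ∀ L → ⟪ L , z ⟫ + points i * ⟪ L , u ⟫ ≈ ⟪ L , combine 1# z (points i) u ⟫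
      on-line L = sym (trans (⟪,combine⟫ L 1# z (points i) u) (+-congʳ (*-identityˡ _)))

    splitCoef : ∀ {s q} → Form → Form → Chain s → Vec Form q → Fin q → Carrier
    splitCoef z y r K zero    = ⟪ head K , y ⟫ * chainEval r (tail K)
    splitCoef z y r K (suc j) = ⟪ head K , z ⟫ * splitCoef z y r (tail K) j

    -- The coefficient of tʲ comes from the words on which the chain leaves its first state after j letters.
    chainEval-scale : ∀ {s q} t z y (r : Chain s) (K : Vec Form q) →
                      chainEval (step (scale t z) y r) K ≈ evalₚ (splitCoef z y r K) t
    chainEval-scale {q = zero}  t z y r K = refl
    chainEval-scale {q = suc q} t z y r K = begin
      ⟪ H , scale t z ⟫ * chainEval (step (scale t z) y r) (tail K) + e
        ≈⟨ +-congʳ (*-cong (⟪,scale⟫ H t z) (chainEval-scale t z y r (tail K))) ⟩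
      t * ⟪ H , z ⟫ * evalₚ b t + e
        ≈⟨ +-comm _ e ⟩
      e + t * ⟪ H , z ⟫ * evalₚ b t
        ≈⟨ +-congˡ (trans (*-assoc t ⟪ H , z ⟫ (evalₚ b t)) (*-congˡ (sym (evalₚ-scale ⟪ H , z ⟫ b t)))) ⟩
      e + t * evalₚ (λ j → ⟪ H , z ⟫ * b j) t ∎
      where
      H = head K
      b = splitCoef z y r (tail K)
      e = ⟪ H , y ⟫ * chainEval r (tail K)

    -- splitAt y r j: read letters before j at z, letter j at y, and the letters after j by the chain r.
    data Plan (s q : ℕ) : Set c where
      whole   : Plan s q
      splitAt : Form → Chain s → Fin q → Plan s q

    later : ∀ {s q} → Plan s q → Plan s (suc q)
    later whole           = whole
    later (splitAt y r j) = splitAt y r (suc j)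

    planEval : ∀ {s q} → Form → Plan s q → Vec Form q → Carrier
    planEval z whole           K = chainEval (stop {0} z) K
    planEval z (splitAt y r j) K = splitCoef z y r K j

    planEval-later : ∀ {s q} z (p : Plan s q) K → planEval z (later p) K ≡ ⟪ head K , z ⟫ * planEval z p (tail K)
    planEval-later z whole           K = ≡.refl
    planEval-later z (splitAt y r j) K = ≡.refl

    -- The claim proved by induction on the number s of products. A chain gets as many states as
    -- there are products, which is where matrices of size s come from.
    Separable : ℕ → Set (c ⊔ ℓ₂)
    Separable s = ∀ {q} → q ≤ D → (a : Fin s → Carrier) (K : Fin s → Vec Form q) (w : Word n) →
      sum (λ i → a i * coef (K i) w) # 0# → ∃ λ (r : Chain s) → sum (λ i → a i * chainEval r (K i)) # 0#

    -- Product `k` has weight zero and can be left out, so a chain with one state fewer than there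
    -- are products is enough.
    separable-vanishing : ∀ {s} → Separable s → ∀ {q} → q ≤ D →
      (a : Fin (suc s) → Carrier) (K : Fin (suc s) → Vec Form q) (w : Word n) →
      ∀ k → a k ≈ 0# → sum (λ i → a i * coef (K i) w) # 0# →
      ∃ λ (r : Chain s) → sum (λ i → a i * chainEval r (K i)) # 0#
    separable-vanishing {s} sep q≤D a K w k aₖ≈0 Σ#0 = r , #-congʳ (sym (omit (λ i → chainEval r (K i)))) (proj₂ found)
      where
      omit : ∀ φ → sum (λ i → a i * φ i) ≈ sum (λ i → a (punchIn k i) * φ (punchIn k i))
      omit φ = begin
        sum (λ i → a i * φ i)                                          ≈⟨ sum-remove {i = k} (λ i → a i * φ i) ⟩
        a k * φ k + sum (λ i → a (punchIn k i) * φ (punchIn k i))      ≈⟨ +-congʳ (trans (*-congʳ aₖ≈0) (zeroˡ (φ k))) ⟩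
        0# + sum (λ i → a (punchIn k i) * φ (punchIn k i))             ≈⟨ +-identityˡ _ ⟩
        sum (λ i → a (punchIn k i) * φ (punchIn k i))                  ∎
      found = sep q≤D (a ∘ punchIn k) (K ∘ punchIn k) w (#-congʳ (omit (λ i → coef (K i) w)) Σ#0)
      r = proj₁ found

    -- V collects the pivots of the letters already read; keeping them nonzero at z lets the
    -- plan found for the shorter tails be pulled back through those letters.
    find-plan : ∀ {s} → Separable s → ∀ {q} (V : List Form) → length V ℕ+ q ≤ D → All NonzeroForm V →
      (a : Fin (suc s) → Carrier) (K : Fin (suc s) → Vec Form q) (w : Word n) → sum (λ i → a i * coef (K i) w) # 0# →
      ∃₂ λ z (p : Plan s q) → All (λ L → ⟪ L , z ⟫ # 0#) V × sum (λ i → a i * planEval z p (K i)) # 0#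
    -- No letter is left, so the sum is just that of the weights, and `z` has only to be a common
    -- nonzero of the collected pivots.
    find-plan sep {zero} V len V#0 a K [] Σ#0 = z , whole , V[z]#0 , Σ#0
      where
      found = common-nonzero V (≤-trans (m≤m+n (length V) 0) len) V#0
      z = proj₁ found
      V[z]#0 = proj₂ found
    find-plan sep {zero}  V len V#0 a K (x ∷ w) Σ#0 = ⊥-elim (x≈0⇒¬x#0 (sum-zero (λ i → zeroʳ (a i))) Σ#0)
    find-plan sep {suc q} V len V#0 a K []      Σ#0 = ⊥-elim (x≈0⇒¬x#0 (sum-zero (λ i → zeroʳ (a i))) Σ#0)
    find-plan {s} sep {suc q} V len V#0 a K (x ∷ w) Σ#0 =
      -- The recursive call read this letter through the coefficients α of `x`, while a chain must
      -- read it through the values β at z. Either the exchange keeps the sum apart from 0, or a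
      -- minor of α and β is apart from 0.
      [ common , split ]′ (weighted-sum⊎minor#0 a α β φ k βₖ#0 (proj₂ V′[z]#0×Σ#0))
      where
      H = λ i → head (K i)
      T = λ i → tail (K i)
      α = λ i → H i x
      κ = λ i → coef (T i) w

      -- Some term of the sum is apart from 0, so its head form has a coefficient at `x` apart from
      -- 0; that form is the pivot.
      pivot = sum#0 {f = λ i → a i * (α i * κ i)} Σ#0
      k = proj₁ pivot
      αₖ#0 : α k # 0#
      αₖ#0 = xy#0⇒x#0 {α k} {κ k} (xy#0⇒y#0 {a k} (proj₂ pivot))

      -- The coefficients of `x` move into the weights. Adding the pivot `H k` to `V` ensures that
      -- its value at the returned `z` is apart from 0, and the length of `V` grows by one as q
      -- shrinks by one.
      rec = find-plan sep (H k ∷ V) (≤-trans (≤-reflexive (≡.sym (+-suc (length V) q))) len)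
              ((unit x , #-congʳ (sym (⟪,unit⟫ (H k) x)) αₖ#0) ∷ V#0)
              (λ i → a i * α i) T w (#-congʳ (sum-cong-≋ (λ i → sym (*-assoc (a i) (α i) (κ i)))) Σ#0)
      z = proj₁ rec
      p = proj₁ (proj₂ rec)
      V′[z]#0×Σ#0 = proj₂ (proj₂ rec)
      β = λ i → ⟪ H i , z ⟫
      φ = λ i → planEval z p (T i)
      βₖ#0 : β k # 0#
      βₖ#0 = All.head (proj₁ V′[z]#0×Σ#0)
      V[z]#0 = All.tail (proj₁ V′[z]#0×Σ#0)

      Result : Set _
      Result = ∃₂ λ z (p : Plan s (suc q)) → All (λ L → ⟪ L , z ⟫ # 0#) V × sum (λ i → a i * planEval z p (K i)) # 0#

      common : sum (λ i → a i * (β i * φ i)) # 0# → Result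
      common Σ′#0 = z , later p , V[z]#0 ,
        #-congʳ (sum-cong-≋ (λ i → *-congˡ {a i} (reflexive (≡.sym (planEval-later z p (K i)))))) Σ′#0

      split : (∃ λ l → minor a α β k l # 0#) → Result
      split (l , m#0) = z , splitAt y r zero , V[z]#0 , #-congʳ regroup (proj₂ found)
        where
        -- The plan for the tails is dropped here. The original coefficients κ of the tails are used
        -- again, now with weights one of which vanishes.
        h×Σ#0 = minor-sum#0 a α β κ k l m#0 Σ#0
        h = proj₁ h×Σ#0
        -- This functional takes each head form `H i` to the minor of columns h and i, so it kills
        -- `H h`.
        y = combine (β h) (unit x) (- α h) z
        H[y] : ∀ i → ⟪ H i , y ⟫ ≈ minor a α β h i
        H[y] i = trans (⟪,combine⟫ (H i) (β h) (unit x) (- α h) z) (+-congʳ (*-congˡ (⟪,unit⟫ (H i) x)))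
        found = separable-vanishing sep (≤-trans (n≤1+n q) (≤-trans (m≤n+m (suc q) (length V)) len))
                  (λ i → a i * minor a α β h i) T w h
                  (trans (*-congˡ (minor-diagonal a α β h)) (zeroʳ (a h))) (proj₂ h×Σ#0)
        r = proj₁ found
        regroup : sum (λ i → a i * minor a α β h i * chainEval r (T i)) ≈ sum (λ i → a i * (⟪ H i , y ⟫ * chainEval r (T i)))
        regroup = sum-cong-≋ (λ i → trans (*-assoc (a i) (minor a α β h i) (chainEval r (T i))) (*-congˡ (*-congʳ (sym (H[y] i)))))

    chainEval-stop : ∀ {s s′ q} z (K : Vec Form q) → chainEval (stop {s} z) K ≡ chainEval (stop {s′} z) K
    chainEval-stop {q = zero}       z K = ≡.refl
    chainEval-stop {s} {s′} {suc q} z K = ≡.cong (⟪ head K , z ⟫ *_) (chainEval-stop {s} {s′} z (tail K))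

    -- For a split at letter j, the sum in the hypothesis is the coefficient of the j-th power of t
    -- in the value of the chain with its first point scaled by t. That polynomial has q
    -- coefficients and q ≤ D, so one of the first q given points is a suitable t.
    plan⇒chain : ∀ {s q} → q ≤ D → (a : Fin (suc s) → Carrier) (K : Fin (suc s) → Vec Form q) → ∀ z (p : Plan s q) →
      sum (λ i → a i * planEval z p (K i)) # 0# → ∃ λ (r : Chain (suc s)) → sum (λ i → a i * chainEval r (K i)) # 0#
    plan⇒chain {s} q≤D a K z whole Σ#0 = stop z ,
      #-congʳ (sum-cong-≋ (λ i → *-congˡ {a i} (reflexive (chainEval-stop {0} {s} z (K i))))) Σ#0
    plan⇒chain {s} {q} q≤D a K z (splitAt y r j) Σ#0 = step (scale t z) y r , #-congʳ expand (proj₂ found)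
      where
      b = λ i j → a i * splitCoef z y r (K i) j
      choose : Fin q → Carrier
      choose i = points (inject≤ i (m≤n⇒m≤1+n q≤D))
      found = nonroot (λ j → sum (λ i → b i j)) choose (λ i≢j → apart (i≢j ∘ inject≤-injective _ _ _ _)) (j , Σ#0)
      t = choose (proj₁ found)
      expand : evalₚ (λ j → sum (λ i → b i j)) t ≈ sum (λ i → a i * chainEval (step (scale t z) y r) (K i))
      expand = trans (evalₚ-sum b t) (sum-cong-≋ (λ i →
        trans (evalₚ-scale (a i) (splitCoef z y r (K i)) t) (*-congˡ (sym (chainEval-scale t z y r (K i))))))

    separable : ∀ s → Separable s
    separable zero    q≤D a K w Σ#0 = ⊥-elim (¬0#0 Σ#0)
    separable (suc s) q≤D a K w Σ#0 = let z , p , _ , Σ′#0 = find-plan (separable s) [] q≤D [] a K w Σ#0 in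
      plan⇒chain q≤D a K z p Σ′#0

  -- Coefficients and concatenation of products of forms.

  prodEval-zero : ∀ {q} (K : Vec Form q) → prodEval K (λ _ → 0#) ≈ 0#
  prodEval-zero {zero}  K = refl
  prodEval-zero {suc q} K = sum-zero (λ x → trans (*-congˡ (prodEval-zero (tail K))) (zeroʳ (head K x)))

  indicator : Word n → Word n → Carrier
  indicator w v = if does (≡-dec _≟_ v w) then 1# else 0#

  indicator-∷ : ∀ x w y v → indicator (x ∷ w) (y ∷ v) ≈ unit x y * indicator w v
  indicator-∷ x w y v = if-∧ (does (y ≟ x)) (does (≡-dec _≟_ v w))
    where
    if-∧ : ∀ b b′ → (if b ∧ b′ then 1# else 0#) ≈ (if b then 1# else 0#) * (if b′ then 1# else 0#)
    if-∧ true  b′ = sym (*-identityˡ _)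
    if-∧ false b′ = sym (zeroˡ _)

  prodEval-indicator : ∀ {q} (K : Vec Form q) w → prodEval K (indicator w) ≈ coef K w
  prodEval-indicator {zero}  K []      = refl
  prodEval-indicator {zero}  K (x ∷ w) = refl
  prodEval-indicator {suc q} K []      = prodEval-zero K
  prodEval-indicator {suc q} K (x ∷ w) = begin
    sum (λ y → head K y * prodEval (tail K) (λ v → indicator (x ∷ w) (y ∷ v)))
      ≈⟨ sum-cong-≋ (λ y → *-congˡ {head K y} (trans (prodEval-cong (tail K) (indicator-∷ x w y))
           (prodEval-* (tail K) (unit x y) (indicator w)))) ⟩
    sum (λ y → head K y * (unit x y * e))
      ≈⟨ sum-cong-≋ (λ y → solve 3 (λ h u e → h :* (u :* e) := u :* (h :* e)) refl (head K y) (unit x y) e) ⟩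
    sum (λ y → unit x y * (head K y * e))
      ≈⟨ sum-δ x (λ y → head K y * e) ⟩
    head K x * e
      ≈⟨ *-congˡ (prodEval-indicator (tail K) w) ⟩
    head K x * coef (tail K) w ∎
    where
    e = prodEval (tail K) (indicator w)

  coef#0⇒length : ∀ {q} (K : Vec Form q) w → coef K w # 0# → length w ≡ q
  coef#0⇒length {zero}  K []      _   = ≡.refl
  coef#0⇒length {zero}  K (x ∷ w) 0#0 = ⊥-elim (¬0#0 0#0)
  coef#0⇒length {suc q} K []      0#0 = ⊥-elim (¬0#0 0#0)
  coef#0⇒length {suc q} K (x ∷ w) p   = ≡.cong suc (coef#0⇒length (tail K) w (xy#0⇒y#0 p))

  prodEval-++ : ∀ {p q} (J : Vec Form p) (K : Vec Form q) E →
                prodEval (J ++ᵛ K) E ≈ prodEval J (λ v → prodEval K (λ w → E (v ++ w)))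
  prodEval-++ []      K E = refl
  prodEval-++ (L ∷ J) K E = sum-cong-≋ (λ x → *-congˡ {L x} (prodEval-++ J K (E ∘ (x ∷_))))

-- Linear functionals on polynomials.

module Pairing {c ℓ₁ ℓ₂} (F : HeytingField c ℓ₁ ℓ₂) (n : ℕ) where

  open FieldLemmas F
  open Polynomials F using (Word; Poly; coeff; _≈ₚ_; constₚ; _+ₚ_; _*ₚ_; Matrix; eval; evalWord)

  -- The linear extension of `E` to polynomials. Coefficients and entries of matrix values are both
  -- of this form, so one decomposition of `f` under all `E` serves both.
  pairing : Poly n → (Word n → Carrier) → Carrier
  pairing []            E = 0#
  pairing ((a , w) ∷ f) E = a * E w + pairing f E

  pairing-+ₚ : ∀ f g E → pairing (f +ₚ g) E ≈ pairing f E + pairing g E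
  pairing-+ₚ []            g E = sym (+-identityˡ _)
  pairing-+ₚ ((a , w) ∷ f) g E = trans (+-congˡ (pairing-+ₚ f g E)) (sym (+-assoc (a * E w) (pairing f E) (pairing g E)))

  pairing-shift : ∀ a v g E → pairing (map (λ (b , w) → a * b , v ++ w) g) E ≈ a * pairing g (E ∘ (v ++_))
  pairing-shift a v []            E = sym (zeroʳ a)
  pairing-shift a v ((b , w) ∷ g) E = begin
    a * b * E (v ++ w) + pairing (map (λ (b , w) → a * b , v ++ w) g) E
      ≈⟨ +-cong (*-assoc a b (E (v ++ w))) (pairing-shift a v g E) ⟩
    a * (b * E (v ++ w)) + a * pairing g (E ∘ (v ++_))                   ≈⟨ distribˡ a _ _ ⟨
    a * (b * E (v ++ w) + pairing g (E ∘ (v ++_)))                       ∎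

  pairing-*ₚ : ∀ f g E → pairing (f *ₚ g) E ≈ pairing f (λ v → pairing g (E ∘ (v ++_)))
  pairing-*ₚ []            g E = refl
  pairing-*ₚ ((a , v) ∷ f) g E = trans (pairing-+ₚ (map (λ (b , w) → a * b , v ++ w) g) (f *ₚ g) E)
    (+-cong (pairing-shift a v g E) (pairing-*ₚ f g E))

  pairing-cong : ∀ f {E E′} → (∀ w → E w ≈ E′ w) → pairing f E ≈ pairing f E′
  pairing-cong []            E≈E′ = refl
  pairing-cong ((a , w) ∷ f) E≈E′ = +-cong (*-congˡ (E≈E′ w)) (pairing-cong f E≈E′)

  pairing-constₚ : ∀ a E → pairing (constₚ a) E ≈ a * E []
  pairing-constₚ a E = +-identityʳ _

  pairing-constₚ-*ₚ : ∀ a f E → pairing (constₚ a *ₚ f) E ≈ a * pairing f E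
  pairing-constₚ-*ₚ a f E = trans (pairing-*ₚ (constₚ a) f E) (+-identityʳ _)

  eval≈pairing : ∀ {s} (M : Fin n → Matrix s) f i j → eval M f i j ≈ pairing f (λ w → evalWord M w i j)
  eval≈pairing M []            i j = refl
  eval≈pairing M ((a , w) ∷ f) i j = +-congˡ (eval≈pairing M f i j)

  coeff≈pairing : ∀ f w → coeff f w ≈ pairing f (LinearForms.indicator F n w)
  coeff≈pairing []            w = refl
  coeff≈pairing ((a , v) ∷ f) w = +-cong (if-* (does (≡-dec _≟_ v w))) (coeff≈pairing f w)
    where
    if-* : ∀ b → (if b then a else 0#) ≈ a * (if b then 1# else 0#)
    if-* true  = sym (*-identityʳ a)
    if-* false = sym (zeroʳ a)

  sumOver : List (Word n) → (Word n → Carrier) → Carrier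
  sumOver []      φ = 0#
  sumOver (w ∷ W) φ = φ w + sumOver W φ

  sumOver-zero : ∀ W {φ} → All (λ w → φ w ≈ 0#) W → sumOver W φ ≈ 0#
  sumOver-zero []      []           = refl
  sumOver-zero (w ∷ W) (φw≈0 ∷ φ≈0) = trans (+-cong φw≈0 (sumOver-zero W φ≈0)) (+-identityˡ 0#)

  sumOver-cong : ∀ W {φ ψ} → (∀ w → φ w ≈ ψ w) → sumOver W φ ≈ sumOver W ψ
  sumOver-cong []      φ≈ψ = refl
  sumOver-cong (w ∷ W) φ≈ψ = +-cong (φ≈ψ w) (sumOver-cong W φ≈ψ)

  sumOver-+ : ∀ W φ ψ → sumOver W (λ w → φ w + ψ w) ≈ sumOver W φ + sumOver W ψ
  sumOver-+ []      φ ψ = sym (+-identityˡ 0#)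
  sumOver-+ (w ∷ W) φ ψ = trans (+-congˡ (sumOver-+ W φ ψ))
    (solve 4 (λ a b p q → a :+ b :+ (p :+ q) := a :+ p :+ (b :+ q)) refl (φ w) (ψ w) (sumOver W φ) (sumOver W ψ))

  sumOver-δ : ∀ {W} a v (E : Word n → Carrier) → Unique W → v ∈ W →
              sumOver W (λ w → (if does (≡-dec _≟_ v w) then a else 0#) * E w) ≈ a * E v
  sumOver-δ {w ∷ W} a v E (w∉W ∷ unique) (here ≡.refl) = trans
    (+-cong (reflexive (≡.cong (λ b → (if b then a else 0#) * E v) (dec-true (≡-dec _≟_ v v) ≡.refl)))
            (sumOver-zero W (All.map vanish w∉W)))
    (+-identityʳ _)
    where
    vanish : ∀ {u} → v ≢ u → (if does (≡-dec _≟_ v u) then a else 0#) * E u ≈ 0#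
    vanish {u} v≢u = trans
      (reflexive (≡.cong (λ b → (if b then a else 0#) * E u) (dec-false (≡-dec _≟_ v u) v≢u)))
      (zeroˡ (E u))
  sumOver-δ {w ∷ W} a v E (w∉W ∷ unique) (there v∈W) = trans
    (+-cong (trans (reflexive (≡.cong (λ b → (if b then a else 0#) * E w)
              (dec-false (≡-dec _≟_ v w) (All.lookup w∉W v∈W ∘ ≡.sym)))) (zeroˡ (E w)))
            (sumOver-δ a v E unique v∈W))
    (+-identityˡ _)

  -- Terms with the same word are collected. As `W` has no repetitions, each term is counted exactly
  -- once, by `sumOver-δ`.
  pairing-coeff : ∀ {W} f E → Unique W → All (λ t → proj₂ t ∈ W) f →
                  pairing f E ≈ sumOver W (λ w → coeff f w * E w)
  pairing-coeff {W} []            E unique []          = sym (sumOver-zero W (All.universal (λ w → zeroˡ (E w)) W))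
  pairing-coeff {W} ((a , v) ∷ f) E unique (v∈W ∷ f⊆W) = begin
    a * E v + pairing f E
      ≈⟨ +-cong (sumOver-δ a v E unique v∈W) (sym (pairing-coeff f E unique f⊆W)) ⟨
    sumOver W (λ w → δ w * E w) + sumOver W (λ w → coeff f w * E w)
      ≈⟨ sumOver-+ W (λ w → δ w * E w) (λ w → coeff f w * E w) ⟨
    sumOver W (λ w → δ w * E w + coeff f w * E w)
      ≈⟨ sumOver-cong W (λ w → distribʳ (E w) (δ w) (coeff f w)) ⟨
    sumOver W (λ w → (δ w + coeff f w) * E w) ∎
    where
    δ : Word n → Carrier
    δ w = if does (≡-dec _≟_ v w) then a else 0#

  -- Equal polynomials may have different lists of terms, so both pairings are rewritten as sums of
  -- coefficients over one list of all words occurring in either.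
  pairing-≈ₚ : ∀ f g → f ≈ₚ g → ∀ E → pairing f E ≈ pairing g E
  pairing-≈ₚ f g f≈g E = begin
    pairing f E
      ≈⟨ pairing-coeff f E unique (All.tabulate (λ t∈f → ∈W (∈-++⁺ˡ (∈-map⁺ proj₂ t∈f)))) ⟩
    sumOver W (λ w → coeff f w * E w)     ≈⟨ sumOver-cong W (λ w → *-congʳ (f≈g w)) ⟩
    sumOver W (λ w → coeff g w * E w)
      ≈⟨ pairing-coeff g E unique (All.tabulate (λ t∈g → ∈W (∈-++⁺ʳ (map proj₂ f) (∈-map⁺ proj₂ t∈g)))) ⟨
    pairing g E                           ∎
    where
    words = map proj₂ f ++ map proj₂ g
    W = deduplicate (≡-dec _≟_) words
    unique : Unique W
    unique = deduplicate-! (≡-dec _≟_) words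
    ∈W : ∀ {w} → w ∈ words → w ∈ W
    ∈W = ∈-deduplicate⁺ (≡-dec _≟_)

-- From circuits to sums of products of linear forms.

module CircuitProducts {c ℓ₁ ℓ₂} (F : HeytingField c ℓ₁ ℓ₂) (n : ℕ) where

  open FieldLemmas F
  open LinearForms F n
  open Pairing F n
  open Polynomials F using (Poly; constₚ; varₚ; _+ₚ_; _*ₚ_)
  open Circuits F n

  -- Equality with the product is expressed through all functionals `E`, so the product need not be
  -- written out as a list of terms.
  IsProduct : Poly n → ℕ → Set (c ⊔ ℓ₁)
  IsProduct f d = ∃ λ (K : Vec Form d) → ∀ E → pairing f E ≈ prodEval K E

  -- Sum and product gates have nonempty input lists, so following first inputs backwards ends at an
  -- input node. This makes conditions on all paths informative at every gate.
  has-path : ∀ {k} (C : Circuit k) u → ∃ λ p → Path C u p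
  has-path (C ▷ var x)           zero    = _ , source ≡.refl
  has-path (C ▷ scalar a)        zero    = _ , source ≡.refl
  has-path (C ▷ sumG (t ∷ ts))   zero    = _ , wire (here ≡.refl) (proj₂ (has-path C (proj₂ t)))
  has-path (C ▷ prodG (u ∷ us))  zero    = _ , wire (here ≡.refl) (proj₂ (has-path C u))
  has-path (C ▷ g)               (suc u) = _ , older (proj₂ (has-path C u))

  -- Any other kind of gate has a path whose last gate is of that kind, contrary to the hypothesis.
  variable-gate : ∀ {k} (C : Circuit k) u → (∀ {p} → Path C u p → p ≡ varK ∷ []) →
                  ∃ λ x → polyAt C u ≡ varₚ x × syntacticDegreeAt C u ≡ 1
  variable-gate (C ▷ var x)           zero    paths = x , ≡.refl , ≡.refl
  variable-gate (C ▷ scalar a)        zero    paths with () ← paths (source ≡.refl)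
  variable-gate (C ▷ sumG (t ∷ ts))   zero    paths with () ← paths (wire (here ≡.refl) (proj₂ (has-path C (proj₂ t))))
  variable-gate (C ▷ prodG (u ∷ us))  zero    paths with () ← paths (wire (here ≡.refl) (proj₂ (has-path C u)))
  variable-gate (C ▷ g)               (suc u) paths = variable-gate C u (paths ∘ older)

  linearCombination : ∀ {k} → (Fin k → Poly n) → List (Carrier × Fin k) → Poly n
  linearCombination ρ us = foldr _+ₚ_ [] (map (λ (a , u) → constₚ a *ₚ ρ u) us)

  pairing-linearCombination-∷ : ∀ {k} (ρ : Fin k → Poly n) a u us E →
    pairing (linearCombination ρ ((a , u) ∷ us)) E ≈ a * pairing (ρ u) E + pairing (linearCombination ρ us) E
  pairing-linearCombination-∷ ρ a u us E = trans (pairing-+ₚ (constₚ a *ₚ ρ u) (linearCombination ρ us) E)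
    (+-congʳ (pairing-constₚ-*ₚ a (ρ u) E))

  ⟪+,⟫ : ∀ a L L′ z → ⟪ (λ y → a * L y + L′ y) , z ⟫ ≈ a * ⟪ L , z ⟫ + ⟪ L′ , z ⟫
  ⟪+,⟫ a L L′ z = begin
    sum (λ y → (a * L y + L′ y) * z y)
      ≈⟨ sum-cong-≋ (λ y → solve 4 (λ a l l′ z → (a :* l :+ l′) :* z := a :* (l :* z) :+ l′ :* z)
          refl a (L y) (L′ y) (z y)) ⟩
    sum (λ y → a * (L y * z y) + L′ y * z y)
      ≈⟨ ∑-distrib-+ (λ y → a * (L y * z y)) (λ y → L′ y * z y) ⟩
    sum (λ y → a * (L y * z y)) + ⟪ L′ , z ⟫
      ≈⟨ +-congʳ (*-distribˡ-sum a (λ y → L y * z y)) ⟨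
    a * ⟪ L , z ⟫ + ⟪ L′ , z ⟫ ∎

  linearForm : ∀ {k} (ρ : Fin k → Poly n) us → All (λ t → ∃ λ x → ρ (proj₂ t) ≡ varₚ x) us →
               ∃ λ (L : Form) → ∀ E → pairing (linearCombination ρ us) E ≈ ⟪ L , (λ x → E (x ∷ [])) ⟫
  linearForm ρ []             []                 = (λ _ → 0#) , λ E → sym (sum-zero (λ x → zeroˡ (E (x ∷ []))))
  linearForm ρ ((a , u) ∷ us) ((x , ρu≡x) ∷ vars) = (λ y → a * unit x y + L y) , correct
    where
    rec = linearForm ρ us vars
    L = proj₁ rec
    correct : ∀ E → pairing (linearCombination ρ ((a , u) ∷ us)) E ≈ ⟪ (λ y → a * unit x y + L y) , (λ x → E (x ∷ [])) ⟫
    correct E = begin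
      pairing (linearCombination ρ ((a , u) ∷ us)) E
        ≈⟨ pairing-linearCombination-∷ ρ a u us E ⟩
      a * pairing (ρ u) E + pairing (linearCombination ρ us) E
        ≈⟨ +-cong (*-congˡ (reflexive (≡.cong (λ f → pairing f E) ρu≡x))) (proj₂ rec E) ⟩
      a * (1# * E (x ∷ []) + 0#) + ⟪ L , z ⟫
        ≈⟨ +-congʳ (*-congˡ (trans (+-identityʳ _) (*-identityˡ (E (x ∷ []))))) ⟩
      a * E (x ∷ []) + ⟪ L , z ⟫
        ≈⟨ +-congʳ (*-congˡ (sum-δ x z)) ⟨
      a * ⟪ unit x , z ⟫ + ⟪ L , z ⟫
        ≈⟨ ⟪+,⟫ a (unit x) L z ⟨
      ⟪ (λ y → a * unit x y + L y) , z ⟫ ∎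
      where
      z : Form
      z x = E (x ∷ [])

  product-isProduct : ∀ {k} (ρ : Fin k → Poly n) (δ : Fin k → ℕ) us → All (λ u → IsProduct (ρ u) (δ u)) us →
                      IsProduct (foldr _*ₚ_ (constₚ 1#) (map ρ us)) (ℕ.sum (map δ us))
  product-isProduct ρ δ []       []                 = [] , λ E → trans (pairing-constₚ 1# E) (*-identityˡ (E []))
  product-isProduct ρ δ (u ∷ us) ((J , ρu≈J) ∷ prods) = J ++ᵛ K , correct
    where
    rest = foldr _*ₚ_ (constₚ 1#) (map ρ us)
    rec = product-isProduct ρ δ us prods
    K = proj₁ rec
    correct : ∀ E → pairing (ρ u *ₚ rest) E ≈ prodEval (J ++ᵛ K) E
    correct E = begin
      pairing (ρ u *ₚ rest) E                                 ≈⟨ pairing-*ₚ (ρ u) rest E ⟩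
      pairing (ρ u) (λ v → pairing rest (E ∘ (v ++_)))        ≈⟨ pairing-cong (ρ u) (λ v → proj₂ rec (E ∘ (v ++_))) ⟩
      pairing (ρ u) (λ v → prodEval K (E ∘ (v ++_)))          ≈⟨ ρu≈J (λ v → prodEval K (E ∘ (v ++_))) ⟩
      prodEval J (λ v → prodEval K (E ∘ (v ++_)))             ≈⟨ prodEval-++ J K E ⟨
      prodEval (J ++ᵛ K) E                                    ∎

  maximum-of-ones : ∀ ds → All (_≡ 1) ds → foldr _ℕ⊔_ 0 ds ≤ 1
  maximum-of-ones []       []              = z≤n
  maximum-of-ones (d ∷ ds) (≡.refl ∷ ones) = ⊔-lub ≤-refl (maximum-of-ones ds ones)

  -- The path condition, with no product gates allowed as well, passes down to the inputs. A Σ gate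
  -- forces m = 0, so its inputs are variables and it computes one linear form; a Π gate uses up one
  -- `ΠK` and concatenates the factors of its inputs.
  gate-isProduct : ∀ {k} (C : Circuit k) u →
    (∀ {p} → Path C u p → ∃ λ m → p ≡ replicate m ΠK ++ ΣK ∷ varK ∷ []) →
    IsProduct (polyAt C u) (syntacticDegreeAt C u)
  gate-isProduct (C ▷ g)        (suc u) paths = gate-isProduct C u (paths ∘ older)
  gate-isProduct (C ▷ var x)    zero    paths with paths (source ≡.refl)
  ... | zero  , ()
  ... | suc m , ()
  gate-isProduct (C ▷ scalar a) zero    paths with paths (source ≡.refl)
  ... | zero  , ()
  ... | suc m , ()
  gate-isProduct (C ▷ sumG (t ∷ ts)) zero paths =
    ≡.subst (IsProduct (polyAt (C ▷ sumG (t ∷ ts)) zero)) (≡.sym degree≡1) (proj₁ form ∷ [] , proj₂ form)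
    where
    δ = syntacticDegreeAt C
    input-paths : ∀ {t′} → t′ ∈ t ∷ ts → ∀ {p} → Path C (proj₂ t′) p → p ≡ varK ∷ []
    input-paths t′∈ path with paths (wire (∈-map⁺ proj₂ t′∈) path)
    ... | zero , ≡.refl = ≡.refl
    ... | suc m , ()
    input-variable : All (λ t′ → ∃ λ x → polyAt C (proj₂ t′) ≡ varₚ x × δ (proj₂ t′) ≡ 1) (t ∷ ts)
    input-variable = All.tabulate (λ {t′} t′∈ → variable-gate C (proj₂ t′) (input-paths t′∈))
    form = linearForm (polyAt C) (t ∷ ts) (All.map (λ (x , ρ≡x , _) → x , ρ≡x) input-variable)
    -- The maximum is folded from 0, so it is the first input, present in every Σ gate, that makes
    -- the degree 1.
    degree≡1 : syntacticDegreeAt (C ▷ sumG (t ∷ ts)) zero ≡ 1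
    degree≡1 with All.map (proj₂ ∘ proj₂) input-variable
    ... | δt≡1 ∷ δts≡1 = ≡.trans (≡.cong (_ℕ⊔ _) δt≡1)
      (m≥n⇒m⊔n≡m (maximum-of-ones (map δ (map proj₂ ts)) (All.map⁺ (All.map⁺ δts≡1))))
  gate-isProduct (C ▷ prodG (u ∷ us)) zero paths = product-isProduct (polyAt C) (syntacticDegreeAt C) (u ∷ us)
    (All.tabulate (λ {v} v∈ → gate-isProduct C v (input-paths v∈)))
    where
    input-paths : ∀ {v} → v ∈ u ∷ us → ∀ {p} → Path C v p → ∃ λ m → p ≡ replicate m ΠK ++ ΣK ∷ varK ∷ []
    input-paths v∈ path with paths (wire v∈ path)
    ... | suc m , eq = m , proj₂ (∷-injective eq)

  -- The weights `a` are kept apart from the forms because they are the scalars on the wires into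
  -- the output gate.
  SumOfProducts : ℕ → Poly n → ℕ → Set (c ⊔ ℓ₁)
  SumOfProducts s f d = ∃₂ λ (a : Fin s → Carrier) (K : Fin s → Vec Form d) →
    ∀ E → pairing f E ≈ sum (λ i → a i * prodEval (K i) E)

  linearCombination-sumOfProducts : ∀ {k d} (ρ : Fin k → Poly n) us → All (λ t → IsProduct (ρ (proj₂ t)) d) us →
    SumOfProducts (length (map proj₂ us)) (linearCombination ρ us) d
  linearCombination-sumOfProducts ρ []             []                = (λ ()) , (λ ()) , λ E → refl
  linearCombination-sumOfProducts {d = d} ρ ((a , u) ∷ us) ((J , ρu≈J) ∷ prods) =
    a ∷ᶠ weights , J ∷ᶠ products ,
    λ E → trans (pairing-linearCombination-∷ ρ a u us E) (+-cong (*-congˡ (ρu≈J E)) (proj₂ (proj₂ rec) E))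
    where
    rec = linearCombination-sumOfProducts ρ us prods
    weights = proj₁ rec
    products = proj₁ (proj₂ rec)

  circuit-sumOfProducts : ∀ {k} (C : Circuit (suc k)) → HomogeneousΣΠ*Σ C →
    ∃ λ d → SumOfProducts (topFanIn C) (polyAt C zero) d
  circuit-sumOfProducts (C ▷ sumG us) (homogeneousΣΠ*Σ {d = d} degrees paths) = d ,
    linearCombination-sumOfProducts (polyAt C) (toList us) (All.tabulate input-isProduct)
    where
    input-paths : ∀ {u} → u ∈ inputs (sumG us) → ∀ {p} → Path C u p → ∃ λ m → p ≡ replicate m ΠK ++ ΣK ∷ varK ∷ []
    input-paths u∈ path = let m , eq = paths (wire u∈ path) in suc m , proj₂ (∷-injective eq)
    input-isProduct : ∀ {t} → t ∈ toList us → IsProduct (polyAt C (proj₂ t)) d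
    -- Homogeneity brings all products to the same length `d`, as reading them letter by letter in
    -- parallel requires.
    input-isProduct {t} t∈ = ≡.subst (IsProduct (polyAt C (proj₂ t))) (proj₂ (All.lookup degrees t∈′))
      (gate-isProduct C (proj₂ t) (input-paths t∈′))
      where t∈′ = ∈-map⁺ proj₂ t∈

-- The matrices for a circuit.

theorem3 : ∀ {c ℓ₁ ℓ₂} (F : HeytingField c ℓ₁ ℓ₂) (n s D : ℕ) →
    let open Polynomials F
        open Circuits F n
    in HasMoreThan D Elements →
       (f : Poly n) → NonzeroPoly f → HasDegree f D →
       ∀ {k} (C : Circuit (suc k)) →
       HomogeneousΣΠ*Σ C → topFanIn C ≡ s → ΠFanInBoundedBy D C →
       C Computes f →
       ∃ λ (M : Fin n → Matrix s) → NonzeroMatrix (eval M f)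
theorem3 F n _ D (points , apart) f _ ((w , ∣w∣≡D , f[w]#0) , _) C homogeneous ≡.refl _ C≈f =
  chainMatrix r , start r , end r , #-congʳ (sym value) (proj₂ found)
  where
  open FieldLemmas F
  open LinearForms F n
  open Pairing F n
  open CircuitProducts F n
  open Polynomials F using (coeff; eval; evalWord)
  open Circuits F n using (polyAt; topFanIn)

  decomposition = circuit-sumOfProducts C homogeneous
  d = proj₁ decomposition
  a = proj₁ (proj₂ decomposition)
  K = proj₁ (proj₂ (proj₂ decomposition))

  f≈ΣaK : ∀ E → pairing f E ≈ sum (λ i → a i * prodEval (K i) E)
  f≈ΣaK E = trans (sym (pairing-≈ₚ (polyAt C zero) f C≈f E)) (proj₂ (proj₂ (proj₂ decomposition)) E)

  coefs#0 : sum (λ i → a i * coef (K i) w) # 0#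
  coefs#0 = #-congʳ (begin
    coeff f w                                          ≈⟨ coeff≈pairing f w ⟩
    pairing f (indicator w)                            ≈⟨ f≈ΣaK (indicator w) ⟩
    sum (λ i → a i * prodEval (K i) (indicator w))
      ≈⟨ sum-cong-≋ (λ i → *-congˡ {a i} (prodEval-indicator (K i) w)) ⟩
    sum (λ i → a i * coef (K i) w)                     ∎) f[w]#0

  -- Here `d` is the degree of the product gates and `D` that of `f`. The word `w` of length `D` has
  -- a coefficient apart from 0 in some product, and such words have length `d`.
  d≤D : d ≤ D
  d≤D = let i , p = sum#0 {f = λ i → a i * coef (K i) w} coefs#0 in
    ≤-reflexive (≡.trans (≡.sym (coef#0⇒length (K i) w (xy#0⇒y#0 p))) ∣w∣≡D)

  found = separable points apart (topFanIn C) d≤D a K w coefs#0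
  r = proj₁ found

  -- Under `E = chainWord r` the decomposition of `f` becomes the sum that `separable` keeps apart
  -- from 0, and the same `E` is one entry of the matrix of a word.
  value : eval (chainMatrix r) f (start r) (end r) ≈ sum (λ i → a i * chainEval r (K i))
  value = begin
    eval (chainMatrix r) f (start r) (end r)
      ≈⟨ eval≈pairing (chainMatrix r) f (start r) (end r) ⟩
    pairing f (λ w → evalWord (chainMatrix r) w (start r) (end r))
      ≈⟨ pairing-cong f (evalWord-chainMatrix r) ⟩
    pairing f (chainWord r)
      ≈⟨ f≈ΣaK (chainWord r) ⟩
    sum (λ i → a i * prodEval (K i) (chainWord r))
      ≈⟨ sum-cong-≋ (λ i → *-congˡ {a i} (prodEval-chainWord r (K i))) ⟩
    sum (λ i → a i * chainEval r (K i)) ∎
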